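{- Let $(T,\ell)$ be a pair consisting of a rooted tree $T$ (not necessarily locally finite) and a length function $\ell$ on $T$. Let $T_0$ be the locally finite component of $T$, with the induced length function $\ell_0$ and capacity function $\chi_0$. Then for all $n$, $$n!_{(T,\ell)}=n!_{(T_0,\ell_0,\chi_0)}.$$
   Context: A rooted tree $T$ has root $\mathfrak r$ and edges oriented away from the root; a length function is $\ell:E(T)\to\mathbb R_{+}$ with (strictly) positive values. A leaf is a vertex $v\neq\mathfrak r$ of valence one, or $\mathfrak r$ itself if $T=\{\mathfrak r\}$; $L(T)$ is the set of leaves. $\partial T$ is the set of infinite oriented paths from $\mathfrak r$ and $\widetilde\partial T$ is the union of $\partial T$ and the set of oriented paths from $\mathfrak r$ to a leaf. For $\rho,\tau\in\widetilde\partial T$ (distinct if both in $\partial T$), $\langle\rho,\tau\rangle$ is the sum of $\ell(e)$ over the common edges $e$ of $\rho$ and $\tau$. Factorials without capacity: choose $\rho_0\in\widetilde\partial T$ arbitrarily; given $\rho_0,\dots,\rho_{n-1}$ choose, if possible, $\rho_n\in\widetilde\partial T\setminus\{\rho_0,\dots,\rho_{n-1}\}$ minimizing $\sum_{j<n}\langle\rho,\rho_j\rangle$; $n!_{(T,\ell)}:=\sum_{j<n}\langle\rho_n,\rho_j\rangle$. Factorials with a capacity function $\chi:L(T)\to\{1,2,\dots\}\cup\{\infty\}$ (for locally finite $T$): the same procedure, except that $\rho_n$ is chosen minimizing $\sum_{j<n}\langle\rho,\rho_j\rangle$ among those $\rho\in\widetilde\partial T$ such that either $\rho\in\partial T$ was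 not chosen before, or $\rho$ ends at a leaf $v$ and was chosen strictly fewer than $\chi(v)$ times before; $n!_{(T,\ell,\chi)}:=\sum_{j<n}\langle\rho_n,\rho_j\rangle$. In both cases the resulting numbers are independent of the choices. Locally finite component: let $V_0$ be the set of vertices $v$ of $T$ such that every vertex other than $v$ on the oriented path from $\mathfrak r$ to $v$ has finite valence in $T$ (so $V_0=\{\mathfrak r\}$ if $\mathfrak r$ has infinite valence). $T_0$ is the subtree of $T$ induced on $V_0$, rooted at $\mathfrak r$; $\ell_0$ is the restriction of $\ell$ to $E(T_0)$; for a leaf $v$ of $T_0$, $\chi_0(v)=\infty$ if $v$ has infinite valence in $T$, and $\chi_0(v)=1$ otherwise (in which case $v$ is a leaf of $T$). The equality for all $n$ means that the two sequences have the same length and the same terms. -}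

module Defs where

open import Algebra.Bundles using (CommutativeMonoid)
import Algebra.Properties.CommutativeSemigroup as CommutativeSemigroupProperties
open import Axiom.ExcludedMiddle using (ExcludedMiddle)
open import Data.Empty using (⊥-elim)
open import Data.Fin.Base using (Fin)
open import Data.Irrelevant using ([_])
open import Data.List.Base using (List; []; _∷_; foldr; map)
open import Data.List.Membership.Propositional using (_∈_)
open import Data.List.Relation.Unary.Any using (here; there)
open import Data.List.Relation.Unary.Unique.Propositional using (Unique)
open import Data.Nat.Base as ℕ using (ℕ; zero; suc; _⊔_)
import Data.Nat.Properties as ℕ
open import Data.Product.Base using (Σ; ∃; ∃-syntax; _×_; _,_; proj₁; proj₂)
open import Data.Rational.Base as ℚ using (ℚ; 0ℚ; ½; ∣_∣)
import Data.Rational.Properties as ℚ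
open import Data.Refinement.Base using (Refinement; Refinement-syntax; _,_; value)
open import Data.Sum.Base using (_⊎_; inj₁; inj₂)
open import Data.Vec.Base as Vec using (Vec; []; _∷_)
open import Data.Vec.Relation.Binary.Pointwise.Inductive using (Pointwise)
open import Data.Vec.Relation.Unary.Any using (Any)
open import Function.Bundles using (_⇔_; _↔_)
open import Level using (Level)
open import Relation.Binary.Construct.Closure.ReflexiveTransitive using (Star; ε; _◅_; _◅◅_)
open import Relation.Binary.PropositionalEquality
  using (_≡_; _≢_; refl; sym; trans; cong; subst)
open import Relation.Nullary using (¬_; Dec; yes; no)

------------------------------------------------------------------------
-- Real numbers: Cauchy sequences of rationals, with _≈ℝ_ as equality.

record ℝ : Set where
  constructor mkℝ
  field
    seq    : ℕ → ℚ
    cauchy : ∀ δ → 0ℚ ℚ.< δ →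
             ∃[ N ] (∀ m n → N ℕ.≤ m → N ℕ.≤ n → ∣ seq m ℚ.- seq n ∣ ℚ.< δ)

open ℝ public

infix 4 _≈ℝ_ _≤ℝ_ _<ℝ_
infixl 6 _+ℝ_

_≈ℝ_ : ℝ → ℝ → Set
x ≈ℝ y = ∀ δ → 0ℚ ℚ.< δ →
         ∃[ N ] (∀ n → N ℕ.≤ n → ∣ seq x n ℚ.- seq y n ∣ ℚ.< δ)

_≤ℝ_ : ℝ → ℝ → Set
x ≤ℝ y = ∀ δ → 0ℚ ℚ.< δ → ∃[ N ] (∀ n → N ℕ.≤ n → seq x n ℚ.< seq y n ℚ.+ δ)

_<ℝ_ : ℝ → ℝ → Set
x <ℝ y = ∃[ δ ] (0ℚ ℚ.< δ × ∃[ N ] (∀ n → N ℕ.≤ n → seq x n ℚ.+ δ ℚ.≤ seq y n))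

0ℝ : ℝ
0ℝ = mkℝ (λ _ → 0ℚ) (λ _ 0<δ → 0 , λ _ _ _ _ → 0<δ)

private
  halve : ∀ δ → ½ ℚ.* δ ℚ.+ ½ ℚ.* δ ≡ δ
  halve δ = trans (sym (ℚ.*-distribʳ-+ δ ½ ½)) (ℚ.*-identityˡ δ)

  ½-pos : ∀ {δ} → 0ℚ ℚ.< δ → 0ℚ ℚ.< ½ ℚ.* δ
  ½-pos {δ} 0<δ = subst (ℚ._< ½ ℚ.* δ) (ℚ.*-zeroʳ ½) (ℚ.*-monoʳ-<-pos ½ 0<δ)

  interchange : ∀ a b c d → (a ℚ.+ b) ℚ.- (c ℚ.+ d) ≡ (a ℚ.- c) ℚ.+ (b ℚ.- d)
  interchange a b c d = trans (cong ((a ℚ.+ b) ℚ.+_) (ℚ.neg-distrib-+ c d))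
                              (medial a b (ℚ.- c) (ℚ.- d))
    where open CommutativeSemigroupProperties
            (CommutativeMonoid.commutativeSemigroup ℚ.+-0-commutativeMonoid)
            using () renaming (interchange to medial)

_+ℝ_ : ℝ → ℝ → ℝ
x +ℝ y = mkℝ (λ n → seq x n ℚ.+ seq y n) λ δ 0<δ →
  let (M , hx) = cauchy x (½ ℚ.* δ) (½-pos 0<δ)
      (N , hy) = cauchy y (½ ℚ.* δ) (½-pos 0<δ)
  in M ⊔ N , λ m n m≥ n≥ → begin-strict
    ∣ (seq x m ℚ.+ seq y m) ℚ.- (seq x n ℚ.+ seq y n) ∣
      ≡⟨ cong ∣_∣ (interchange (seq x m) (seq y m) (seq x n) (seq y n)) ⟩
    ∣ (seq x m ℚ.- seq x n) ℚ.+ (seq y m ℚ.- seq y n) ∣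
      ≤⟨ ℚ.∣p+q∣≤∣p∣+∣q∣ (seq x m ℚ.- seq x n) (seq y m ℚ.- seq y n) ⟩
    ∣ seq x m ℚ.- seq x n ∣ ℚ.+ ∣ seq y m ℚ.- seq y n ∣
      <⟨ ℚ.+-mono-<
           (hx m n (ℕ.≤-trans (ℕ.m≤m⊔n M N) m≥) (ℕ.≤-trans (ℕ.m≤m⊔n M N) n≥))
           (hy m n (ℕ.≤-trans (ℕ.m≤n⊔m M N) m≥) (ℕ.≤-trans (ℕ.m≤n⊔m M N) n≥)) ⟩
    ½ ℚ.* δ ℚ.+ ½ ℚ.* δ
      ≡⟨ halve δ ⟩
    δ ∎
  where open ℚ.≤-Reasoning

sumℝ : List ℝ → ℝ
sumℝ = foldr _+ℝ_ 0ℝ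

------------------------------------------------------------------------
-- Rooted trees

module _ {a : Level} {V : Set a} {E : V → V → Set a} where

  -- All vertices of an oriented path, both endpoints included.
  vertices : ∀ {u w} → Star E u w → List V
  vertices {u} ε       = u ∷ []
  vertices {u} (_ ◅ p) = u ∷ vertices p

  edges : ∀ {u w} → Star E u w → List (Σ V λ s → Σ V λ t → E s t)
  edges ε       = []
  edges (e ◅ p) = (_ , _ , e) ∷ edges p

-- Every vertex is reached from the root by exactly one oriented path.
-- As paths remember their edges, this rules out parallel edges and loops.
record RootedTree (a : Level) : Set (Level.suc a) where
  field
    Vertex      : Set a
    _⟶_         : Vertex → Vertex → Set a
    root        : Vertex
    path        : ∀ v → Star _⟶_ root v
    path-unique : ∀ {v} (p q : Star _⟶_ root v) → p ≡ q

  Edge : Set a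
  Edge = Σ Vertex λ u → Σ Vertex λ w → u ⟶ w

  -- Edges of either orientation count towards the valence.
  Incident : Vertex → Set a
  Incident v = (∃ λ w → v ⟶ w) ⊎ (∃ λ u → u ⟶ v)

  HasValence : Vertex → ℕ → Set a
  HasValence v n = Incident v ↔ Fin n

  FiniteValence : Vertex → Set a
  FiniteValence v = ∃ λ n → HasValence v n

  IsLeaf : Vertex → Set a
  IsLeaf v = (v ≢ root × HasValence v 1) ⊎ (v ≡ root × (∀ w → w ≡ root))

  -- The proof of leafhood is irrelevant, so that functions on leaves depend
  -- on the vertex alone.
  Leaf : Set a
  Leaf = [ v ∈ Vertex ∣ IsLeaf v ]

  record InfinitePath : Set a where
    field
      at     : ℕ → Vertex
      starts : at 0 ≡ root
      step   : ∀ n → at n ⟶ at (suc n)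

  open InfinitePath public

  -- The extended boundary.  A path from the root to a leaf is represented by
  -- the leaf, since it has to be `path` of that leaf.
  data Boundary : Set a where
    infinite : InfinitePath → Boundary
    toLeaf   : Leaf → Boundary

  -- Equality of paths; infinite ones are compared vertex by vertex.
  data _≈∂_ : Boundary → Boundary → Set a where
    infinite : ∀ {p q} → (∀ n → at p n ≡ at q n) → infinite p ≈∂ infinite q
    toLeaf   : ∀ {v w} → value v ≡ value w → toLeaf v ≈∂ toLeaf w

  _∈ᵉ_ : Edge → Boundary → Set a
  e ∈ᵉ infinite p = ∃ λ n → e ≡ (at p n , at p (suc n) , step p n)
  e ∈ᵉ toLeaf v   = e ∈ edges (path (value v))

record LengthFunction {a : Level} (T : RootedTree a) : Set a where
  open RootedTree T
  field
    length   : Edge → ℝ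
    positive : ∀ e → 0ℝ <ℝ length e

------------------------------------------------------------------------
-- Factorials

module _ {a : Level} (T : RootedTree a) (ℓ : LengthFunction T) where
  open RootedTree T
  open LengthFunction ℓ

  -- ⟨ ρ , τ ⟩ = x.  No such x exists when ρ and τ are the same infinite path.
  Pairing : Boundary → Boundary → ℝ → Set a
  Pairing ρ τ x = Σ (List Edge) λ es →
    Unique es ×
    (∀ e → e ∈ es ⇔ (e ∈ᵉ ρ × e ∈ᵉ τ)) ×
    x ≈ℝ sumℝ (map length es)

  -- The sum of ⟨ ρ , τ ⟩ over all τ in the vector equals s.
  PairingSum : ∀ {n} → Boundary → Vec Boundary n → ℝ → Set a
  PairingSum {n} ρ τs s = Σ (Vec ℝ n) λ xs →
    Pointwise (λ τ x → Pairing ρ τ x) τs xs × s ≈ℝ sumℝ (Vec.toList xs)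

  -- `Admissible τs ρ` says that ρ may be chosen after the choices τs.
  -- Vectors of choices are listed with the most recent choice first.
  module Greedy (Admissible : ∀ {n} → Vec Boundary n → Boundary → Set a) where

    record Choice {n} (τs : Vec Boundary n) (ρ : Boundary) (s : ℝ) : Set a where
      field
        admissible : Admissible τs ρ
        attained   : PairingSum ρ τs s
        minimal    : ∀ ρ′ s′ → Admissible τs ρ′ → PairingSum ρ′ τs s′ → s ≤ℝ s′

    data Run : ∀ {n} → Vec Boundary n → Set a where
      []  : Run []
      _∷_ : ∀ {n} {τs : Vec Boundary n} {ρ s} →
            Choice τs ρ s → Run τs → Run (ρ ∷ τs)

    -- The n-th term of the factorial sequence exists and equals s.  The terms
    -- do not depend on the choices, so it suffices to exhibit one run.
    IsFactorial : ℕ → ℝ → Set a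
    IsFactorial n s = Σ (Vec Boundary n) λ τs →
      Run τs × ∃ λ ρ → Choice τs ρ s

  -- n!_(T,ℓ) = s
  Factorial : ℕ → ℝ → Set a
  Factorial = Greedy.IsFactorial λ τs ρ → ¬ Any (ρ ≈∂_) τs

-- Positive integers together with ∞.
data Capacity : Set where
  fin : (n : ℕ) .{{_ : ℕ.NonZero n}} → Capacity
  ∞   : Capacity

data _<ᶜ_ (m : ℕ) : Capacity → Set where
  fin : ∀ {n} .{{_ : ℕ.NonZero n}} → m ℕ.< n → m <ᶜ fin n
  ∞   : m <ᶜ ∞

CapacityFunction : {a : Level} → RootedTree a → Set a
CapacityFunction T = RootedTree.Leaf T → Capacity

module _ {a : Level} (em : ExcludedMiddle a)
         (T : RootedTree a) (ℓ : LengthFunction T) (χ : CapacityFunction T) where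
  open RootedTree T

  -- Excluded middle is needed to count how often ρ occurs among the choices.
  data AdmissibleWithCapacity {n} (τs : Vec Boundary n) : Boundary → Set a where
    infinite : ∀ {p} → ¬ Any (infinite p ≈∂_) τs →
               AdmissibleWithCapacity τs (infinite p)
    toLeaf   : ∀ {v} → Vec.count (λ τ → em {toLeaf v ≈∂ τ}) τs <ᶜ χ v →
               AdmissibleWithCapacity τs (toLeaf v)

  -- n!_(T,ℓ,χ) = s
  FactorialWithCapacity : ℕ → ℝ → Set a
  FactorialWithCapacity = Greedy.IsFactorial T ℓ AdmissibleWithCapacity

------------------------------------------------------------------------
-- The locally finite component

module _ {a : Level} (T : RootedTree a) where
  open RootedTree T

  InV₀ : Vertex → Set a
  InV₀ v = ∀ w → w ∈ vertices (path v) → w ≢ v → FiniteValence w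

  V₀ : Set a
  V₀ = [ v ∈ Vertex ∣ InV₀ v ]

  _⟶₀_ : V₀ → V₀ → Set a
  u ⟶₀ w = value u ⟶ value w

  len : ∀ {u w} → Star _⟶_ u w → ℕ
  len ε       = 0
  len (_ ◅ p) = suc (len p)

  len-◅◅ : ∀ {u v w} (p : Star _⟶_ u v) (q : Star _⟶_ v w) →
           len (p ◅◅ q) ≡ len p ℕ.+ len q
  len-◅◅ ε       q = refl
  len-◅◅ (_ ◅ p) q = cong suc (len-◅◅ p q)

  no-cycle : ∀ {u w} → u ⟶ w → ¬ Star _⟶_ w u
  no-cycle {u} e q = ℕ.m≢1+m+n (len (path u)) (trans
    (cong len (path-unique (path u) (path u ◅◅ e ◅ q)))
    (trans (len-◅◅ (path u) (e ◅ q)) (ℕ.+-suc _ _)))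

  -- Every vertex of a path has a path to the end point.
  rest : ∀ {u w x} (p : Star _⟶_ u w) → x ∈ vertices p → Star _⟶_ x w
  rest ε       (here refl) = ε
  rest (e ◅ p) (here refl) = e ◅ p
  rest (_ ◅ p) (there i)   = rest p i

  extend : ∀ {u v w x} (p : Star _⟶_ u v) (q : Star _⟶_ v w) →
           x ∈ vertices p → x ∈ vertices (p ◅◅ q)
  extend ε       ε       i         = i
  extend ε       (_ ◅ _) (here eq) = here eq
  extend (_ ◅ _) q       (here eq) = here eq
  extend (_ ◅ p) q       (there i) = there (extend p q i)

  -- V₀ is closed under passing to ancestors.
  ancestor : ∀ {u v} → Star _⟶_ u v → InV₀ v → InV₀ u
  ancestor ε h = h
  ancestor {u} {v} (e ◅ q) h w i w≢u = h w
    (subst (λ p → w ∈ vertices p)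
           (path-unique (path u ◅◅ e ◅ q) (path v))
           (extend (path u) (e ◅ q) i))
    λ { refl → no-cycle e (q ◅◅ rest (path u) i) }

  lift : ∀ {u v} .(iu : InV₀ u) .(iv : InV₀ v) → Star _⟶_ u v →
         Star _⟶₀_ (u , [ iu ]) (v , [ iv ])
  lift iu iv ε       = ε
  lift iu iv (e ◅ p) = e ◅ lift (ancestor p iv) iv p

  lower : ∀ {u v} → Star _⟶₀_ u v → Star _⟶_ (value u) (value v)
  lower ε       = ε
  lower (e ◅ p) = e ◅ lower p

  -- A path of T₀ is recovered from its image in T.
  lift-lower : ∀ {u v} .(iu : InV₀ u) .(iv : InV₀ v)
               (p : Star _⟶₀_ (u , [ iu ]) (v , [ iv ])) →
               p ≡ lift iu iv (lower p)
  lift-lower iu iv ε       = refl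
  lift-lower iu iv (_◅_ {j = w , [ iw ]} e p) = cong (e ◅_) (lift-lower iw iv p)

  root∈V₀ : InV₀ root
  root∈V₀ w i w≢r with path root | path-unique (path root) ε
  root∈V₀ w (here w≡r) w≢r | .ε | refl = ⊥-elim (w≢r w≡r)

  -- The subtree induced on V₀.
  T₀ : RootedTree a
  T₀ = record
    { Vertex      = V₀
    ; _⟶_         = _⟶₀_
    ; root        = root , [ root∈V₀ ]
    ; path        = λ { (v , [ iv ]) → lift root∈V₀ iv (path v) }
    ; path-unique = λ { {v , [ iv ]} p q →
        trans (lift-lower root∈V₀ iv p)
          (trans (cong (lift root∈V₀ iv) (path-unique (lower p) (lower q)))
                 (sym (lift-lower root∈V₀ iv q))) }
    }

  ℓ₀ : LengthFunction T → LengthFunction T₀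
  ℓ₀ ℓ = record
    { length   = λ { (u , w , e) → length (value u , value w , e) }
    ; positive = λ { (u , w , e) → positive (value u , value w , e) }
    }
    where open LengthFunction ℓ

  χ₀ : ExcludedMiddle a → CapacityFunction T₀
  χ₀ em (v , _) with em {FiniteValence (value v)}
  ... | yes _ = fin 1
  ... | no  _ = ∞

{-# OPTIONS --safe #-}
module Submission where

-- Cut each boundary path of T at its first vertex of infinite valence.  This
-- yields a boundary path of T₀, keeps admissibility and does not increase the
-- pairing sums.  Conversely, an admissible path of T₀ is the cut of an unused
-- path of T with the same pairing sums against the earlier choices: at a vertex
-- of infinite valence some child is not used by any of them.  Hence the two
-- minimisation problems have the same value at every step, and greedy choices
-- can be transferred in both directions.
--
-- Existence of infinite paths needs no separate choice principle, since
-- excluded middle for Σ-types produces witnesses.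

open import Axiom.ExcludedMiddle using (ExcludedMiddle)
open import Data.Empty using (⊥; ⊥-elim; ⊥-elim-irr)
open import Data.Fin.Base using (Fin; zero; suc)
open import Data.Irrelevant using ([_])
open import Data.List.Base as List using (List; []; _∷_; lookup; deduplicate)
import Data.List.Properties as List
open import Data.List.Membership.Propositional using (_∈_)
open import Data.List.Membership.Propositional.Properties
  using (∈-lookup; ∈-deduplicate⁺; ∈-map⁺; ∈-map⁻)
open import Data.List.Relation.Binary.Sublist.Propositional using (_⊆_; []; _∷ʳ_; _∷_)
open import Data.List.Relation.Unary.All as All using (All; []; _∷_)
open import Data.List.Relation.Unary.AllPairs using ([]; _∷_)
open import Data.List.Relation.Unary.Any as Any using (here; there)
open import Data.List.Relation.Unary.Any.Properties using (lookup-index)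
open import Data.List.Relation.Unary.Unique.Propositional using (Unique)
import Data.List.Relation.Unary.Unique.DecPropositional.Properties as Unique
open import Data.Maybe.Base using (Maybe; just; nothing)
open import Data.Maybe.Properties using (just-injective)
open import Data.Nat.Base as ℕ using (ℕ; zero; suc; _⊔_; z≤n; s≤s)
import Data.Nat.Properties as ℕ
open import Data.Product.Base using (∃; ∃-syntax; _×_; _,_; proj₁; proj₂)
open import Data.Rational.Base as ℚ using (ℚ; 0ℚ; ½; ∣_∣)
import Data.Rational.Properties as ℚ
open import Data.Rational.Solver using (module +-*-Solver)
open import Data.Refinement.Base using (_,_; value)
open import Data.Sum.Base using (_⊎_; inj₁; inj₂)
open import Data.Vec.Base as Vec using (Vec; []; _∷_)
open import Data.Vec.Relation.Binary.Pointwise.Inductive as Pointwise using (Pointwise; []; _∷_)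
open import Data.Vec.Relation.Unary.All as AllV using ([]; _∷_)
open import Data.Vec.Relation.Unary.Any as AnyV using (here; there)
open import Function.Base using (_∘_)
open import Function.Bundles using (_⇔_; mk⇔; _↔_; mk↔ₛ′; Equivalence; Inverse)
open import Level using (Level)
open import Relation.Binary.Construct.Closure.ReflexiveTransitive using (Star; ε; _◅_; _◅◅_)
open import Relation.Binary.PropositionalEquality
  using (_≡_; refl; sym; trans; cong; subst; subst₂)
open import Relation.Nullary using (¬_; Dec; yes; no)
open import Relation.Nullary.Decidable using (recompute)
open import Defs

-- Real numbers

∣p-q∣<δ⇒p<q+δ : ∀ {p q δ} → ∣ p ℚ.- q ∣ ℚ.< δ → p ℚ.< q ℚ.+ δ
∣p-q∣<δ⇒p<q+δ {p} {q} {δ} h = subst (ℚ._< q ℚ.+ δ) (lemma p q)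
  (ℚ.+-monoʳ-< q (ℚ.≤-<-trans (≤∣∣ (p ℚ.- q)) h))
  where
  open +-*-Solver
  lemma : ∀ p q → q ℚ.+ (p ℚ.- q) ≡ p
  lemma = solve 2 (λ p q → q :+ (p :- q) := p) refl
  ≤∣∣ : ∀ r → r ℚ.≤ ∣ r ∣
  ≤∣∣ r with ℚ.≤-total 0ℚ r
  ... | inj₁ 0≤r = ℚ.≤-reflexive (sym (ℚ.0≤p⇒∣p∣≡p 0≤r))
  ... | inj₂ r≤0 = ℚ.≤-trans r≤0 (ℚ.0≤∣p∣ r)

-[p-q]≡q-p : ∀ p q → ℚ.- (p ℚ.- q) ≡ q ℚ.- p
-[p-q]≡q-p = solve 2 (λ p q → :- (p :- q) := q :- p) refl
  where open +-*-Solver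

q+δ-q≡δ : ∀ q δ → q ℚ.+ δ ℚ.- q ≡ δ
q+δ-q≡δ = solve 2 (λ q δ → q :+ δ :- q := δ) refl
  where open +-*-Solver

∣p-q∣≡∣q-p∣ : ∀ p q → ∣ p ℚ.- q ∣ ≡ ∣ q ℚ.- p ∣
∣p-q∣≡∣q-p∣ p q = trans (sym (ℚ.∣-p∣≡∣p∣ (p ℚ.- q))) (cong ∣_∣ (-[p-q]≡q-p p q))

p<q+δ∧q<p+δ⇒∣p-q∣<δ : ∀ {p q δ} → p ℚ.< q ℚ.+ δ → q ℚ.< p ℚ.+ δ → ∣ p ℚ.- q ∣ ℚ.< δ
p<q+δ∧q<p+δ⇒∣p-q∣<δ {p} {q} {δ} h k with ℚ.∣p∣≡p∨∣p∣≡-p (p ℚ.- q)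
... | inj₁ eq = subst₂ ℚ._<_ (sym eq) (q+δ-q≡δ q δ) (ℚ.+-monoˡ-< (ℚ.- q) h)
... | inj₂ eq = subst₂ ℚ._<_ (trans (sym (-[p-q]≡q-p p q)) (sym eq)) (q+δ-q≡δ p δ) (ℚ.+-monoˡ-< (ℚ.- p) k)

½*-positive : ∀ {δ} → 0ℚ ℚ.< δ → 0ℚ ℚ.< ½ ℚ.* δ
½*-positive {δ} 0<δ = subst (ℚ._< ½ ℚ.* δ) (ℚ.*-zeroʳ ½) (ℚ.*-monoʳ-<-pos ½ 0<δ)

½δ+½δ≡δ : ∀ δ → ½ ℚ.* δ ℚ.+ ½ ℚ.* δ ≡ δ
½δ+½δ≡δ δ = trans (sym (ℚ.*-distribʳ-+ δ ½ ½)) (ℚ.*-identityˡ δ)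

≈ℝ⇒≤ℝ : ∀ {x y} → x ≈ℝ y → x ≤ℝ y
≈ℝ⇒≤ℝ h δ 0<δ = let (N , k) = h δ 0<δ in N , λ n n≥ → ∣p-q∣<δ⇒p<q+δ (k n n≥)

≈ℝ-sym : ∀ {x y} → x ≈ℝ y → y ≈ℝ x
≈ℝ-sym {x} {y} h δ 0<δ = let (N , k) = h δ 0<δ in
  N , λ n n≥ → subst (ℚ._< δ) (∣p-q∣≡∣q-p∣ (seq x n) (seq y n)) (k n n≥)

≈ℝ-refl : ∀ {x} → x ≈ℝ x
≈ℝ-refl {x} δ 0<δ = 0 , λ n _ →
  subst (ℚ._< δ) (sym (cong ∣_∣ (ℚ.+-inverseʳ (seq x n)))) 0<δ

≤ℝ-refl : ∀ {x} → x ≤ℝ x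
≤ℝ-refl {x} = ≈ℝ⇒≤ℝ {x} {x} (≈ℝ-refl {x})

≤ℝ-antisym : ∀ {x y} → x ≤ℝ y → y ≤ℝ x → x ≈ℝ y
≤ℝ-antisym h k δ 0<δ =
  let (M , h′) = h δ 0<δ
      (N , k′) = k δ 0<δ
  in M ⊔ N , λ n n≥ → p<q+δ∧q<p+δ⇒∣p-q∣<δ
       (h′ n (ℕ.≤-trans (ℕ.m≤m⊔n M N) n≥)) (k′ n (ℕ.≤-trans (ℕ.m≤n⊔m M N) n≥))

≤ℝ-trans : ∀ {x y z} → x ≤ℝ y → y ≤ℝ z → x ≤ℝ z
≤ℝ-trans {x} {y} {z} h k δ 0<δ =
  let (M , h′) = h (½ ℚ.* δ) (½*-positive 0<δ)
      (N , k′) = k (½ ℚ.* δ) (½*-positive 0<δ)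
  in M ⊔ N , λ n n≥ → begin-strict
    seq x n
      <⟨ h′ n (ℕ.≤-trans (ℕ.m≤m⊔n M N) n≥) ⟩
    seq y n ℚ.+ ½ ℚ.* δ
      <⟨ ℚ.+-monoˡ-< (½ ℚ.* δ) (k′ n (ℕ.≤-trans (ℕ.m≤n⊔m M N) n≥)) ⟩
    seq z n ℚ.+ ½ ℚ.* δ ℚ.+ ½ ℚ.* δ
      ≡⟨ trans (ℚ.+-assoc (seq z n) (½ ℚ.* δ) (½ ℚ.* δ)) (cong (seq z n ℚ.+_) (½δ+½δ≡δ δ)) ⟩
    seq z n ℚ.+ δ ∎
  where open ℚ.≤-Reasoning

+ℝ-mono-≤ℝ : ∀ {x y u v} → x ≤ℝ y → u ≤ℝ v → x +ℝ u ≤ℝ y +ℝ v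
+ℝ-mono-≤ℝ {x} {y} {u} {v} h k δ 0<δ =
  let (M , h′) = h (½ ℚ.* δ) (½*-positive 0<δ)
      (N , k′) = k (½ ℚ.* δ) (½*-positive 0<δ)
  in M ⊔ N , λ n n≥ → begin-strict
    seq x n ℚ.+ seq u n
      <⟨ ℚ.+-mono-< (h′ n (ℕ.≤-trans (ℕ.m≤m⊔n M N) n≥))
                    (k′ n (ℕ.≤-trans (ℕ.m≤n⊔m M N) n≥)) ⟩
    (seq y n ℚ.+ ½ ℚ.* δ) ℚ.+ (seq v n ℚ.+ ½ ℚ.* δ)
      ≡⟨ interchange (seq y n) (seq v n) (½ ℚ.* δ) ⟩
    (seq y n ℚ.+ seq v n) ℚ.+ (½ ℚ.* δ ℚ.+ ½ ℚ.* δ)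
      ≡⟨ cong (seq y n ℚ.+ seq v n ℚ.+_) (½δ+½δ≡δ δ) ⟩
    (seq y n ℚ.+ seq v n) ℚ.+ δ ∎
  where
  open ℚ.≤-Reasoning
  open +-*-Solver
  interchange : ∀ p q η → (p ℚ.+ η) ℚ.+ (q ℚ.+ η) ≡ (p ℚ.+ q) ℚ.+ (η ℚ.+ η)
  interchange = solve 3 (λ p q η → (p :+ η) :+ (q :+ η) := (p :+ q) :+ (η :+ η)) refl

x≤ℝp+ℝx : ∀ {p} x → 0ℝ <ℝ p → x ≤ℝ p +ℝ x
x≤ℝp+ℝx {p} x (η , 0<η , N , h) δ 0<δ = N , λ n n≥ → begin-strict
    seq x n                      ≡⟨ sym (ℚ.+-identityˡ (seq x n)) ⟩
    0ℚ ℚ.+ seq x n               <⟨ ℚ.+-monoˡ-< (seq x n) (ℚ.<-≤-trans 0<η (η≤ n n≥)) ⟩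
    seq p n ℚ.+ seq x n          ≡⟨ sym (ℚ.+-identityʳ _) ⟩
    seq p n ℚ.+ seq x n ℚ.+ 0ℚ   <⟨ ℚ.+-monoʳ-< (seq p n ℚ.+ seq x n) 0<δ ⟩
    seq p n ℚ.+ seq x n ℚ.+ δ    ∎
  where
  open ℚ.≤-Reasoning
  η≤ : ∀ n → N ℕ.≤ n → η ℚ.≤ seq p n
  η≤ n n≥ = subst (ℚ._≤ seq p n) (ℚ.+-identityˡ η) (h n n≥)

-- Finite enumerations

module _ {a} {A : Set a} where

  lookup-injective : ∀ {xs : List A} → Unique xs → ∀ i j → lookup xs i ≡ lookup xs j → i ≡ j
  lookup-injective (_ ∷ _)      zero    zero    _  = refl
  lookup-injective (x∉xs ∷ _)   zero    (suc j) eq = ⊥-elim (All.lookup x∉xs (∈-lookup j) eq)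
  lookup-injective (x∉xs ∷ _)   (suc i) zero    eq = ⊥-elim (All.lookup x∉xs (∈-lookup i) (sym eq))
  lookup-injective (_ ∷ unique) (suc i) (suc j) eq = cong suc (lookup-injective unique i j eq)

  -- Excluded middle decides equality, so repetitions can be removed from the list; the positions in
  -- the remaining list then number `A`.
  covered⇒finite : ExcludedMiddle a → (xs : List A) → (∀ x → x ∈ xs) → ∃[ n ] (A ↔ Fin n)
  covered⇒finite em xs x∈xs = List.length ys , mk↔ₛ′
    (Any.index ∘ x∈ys) (lookup ys)
    (λ i → lookup-injective (Unique.deduplicate-! _≟_ xs) _ i (sym (lookup-index (x∈ys (lookup ys i)))))
    (λ x → sym (lookup-index (x∈ys x)))
    where
    _≟_ = λ x y → em {x ≡ y}
    ys = deduplicate _≟_ xs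
    x∈ys : ∀ x → x ∈ ys
    x∈ys x = ∈-deduplicate⁺ _≟_ (x∈xs x)

Pointwise-Any : ∀ {a b r p q} {A : Set a} {B : Set b} {R : A → B → Set r}
                {P : A → Set p} {Q : B → Set q} →
                (∀ {x y} → R x y → P x → Q y) →
                ∀ {n} {xs : Vec A n} {ys : Vec B n} →
                Pointwise R xs ys → AnyV.Any P xs → AnyV.Any Q ys
Pointwise-Any f (r ∷ _)  (here p)  = here (f r p)
Pointwise-Any f (_ ∷ rs) (there i) = there (Pointwise-Any f rs i)

module _ {a p} {A : Set a} {P : A → Set p} (P? : ∀ x → Dec (P x)) where

  ¬Any⇒count≡0 : ∀ {n} {xs : Vec A n} → ¬ AnyV.Any P xs → Vec.count P? xs ≡ 0
  ¬Any⇒count≡0 {xs = []}     _    = refl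
  ¬Any⇒count≡0 {xs = x ∷ xs} ¬any with P? x
  ... | yes px = ⊥-elim (¬any (here px))
  ... | no _   = ¬Any⇒count≡0 (¬any ∘ there)

  Any⇒0<count : ∀ {n} {xs : Vec A n} → AnyV.Any P xs → 0 ℕ.< Vec.count P? xs
  Any⇒0<count {xs = x ∷ _} any with P? x
  Any⇒0<count any        | yes _  = s≤s z≤n
  Any⇒0<count (here px)  | no ¬px = ⊥-elim (¬px px)
  Any⇒0<count (there i)  | no _   = Any⇒0<count i

-- Oriented paths in a rooted tree

module Paths {a : Level} (T : RootedTree a) where
  open RootedTree T

  last : ∀ {u w} → Star _⟶_ u w → Maybe (∃ (_⟶ w))
  last ε               = nothing
  last (e ◅ ε)         = just (_ , e)
  last (_ ◅ p@(_ ◅ _)) = last p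

  last-snoc : ∀ {u s t} (p : Star _⟶_ u s) (e : s ⟶ t) → last (p ◅◅ e ◅ ε) ≡ just (s , e)
  last-snoc ε               e = refl
  last-snoc (_ ◅ ε)         e = refl
  last-snoc (_ ◅ p@(_ ◅ _)) e = last-snoc p e

  -- Each edge completes a path from the root to `t`. The two paths are equal, hence so are their
  -- last edges.
  parent-unique : ∀ {s s′ t} (e : s ⟶ t) (e′ : s′ ⟶ t) → (s , e) ≡ (s′ , e′)
  parent-unique {s} {s′} e e′ = just-injective (trans (sym (last-snoc (path s) e))
    (trans (cong last (path-unique (path s ◅◅ e ◅ ε) (path s′ ◅◅ e′ ◅ ε)))
           (last-snoc (path s′) e′)))

  unsnoc : ∀ {u w} → Star _⟶_ u w → u ≡ w ⊎ (∃ λ s → Star _⟶_ u s × s ⟶ w)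
  unsnoc ε = inj₁ refl
  unsnoc (e ◅ p) with unsnoc p
  ... | inj₁ refl        = inj₂ (_ , ε , e)
  ... | inj₂ (s , q , f) = inj₂ (s , e ◅ q , f)

  above-child : ∀ {x s t} → Star _⟶_ x t → s ⟶ t → x ≡ t ⊎ Star _⟶_ x s
  above-child p e with unsnoc p
  ... | inj₁ eq = inj₁ eq
  ... | inj₂ (s , q , f) with parent-unique f e
  ...   | refl = inj₂ q

  -- Induction on the first path: by `above-child`, a vertex above its second vertex is that vertex
  -- or lies above its first.
  comparable : ∀ {u v w} → Star _⟶_ u w → Star _⟶_ v w → Star _⟶_ u v ⊎ Star _⟶_ v u
  comparable ε q = inj₂ q
  comparable (e ◅ p) q with comparable p q
  ... | inj₁ r = inj₁ (e ◅ r)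
  ... | inj₂ r with above-child r e
  ...   | inj₁ refl = inj₁ (e ◅ ε)
  ...   | inj₂ r′   = inj₂ r′

  depth : Vertex → ℕ
  depth v = len T (path v)

  depth-◅◅ : ∀ {u w} (p : Star _⟶_ u w) → depth w ≡ depth u ℕ.+ len T p
  depth-◅◅ {u} {w} p = trans (cong (len T) (path-unique (path w) (path u ◅◅ p))) (len-◅◅ T (path u) p)

  depth-at : ∀ p n → depth (at p n) ≡ n
  depth-at p zero    = trans (cong depth (starts p)) (cong (len T) (path-unique (path root) ε))
  depth-at p (suc n) = trans (depth-◅◅ (step p n ◅ ε)) (trans (ℕ.+-comm _ 1) (cong suc (depth-at p n)))

  -- A non-root vertex has an incoming edge, so a child would be a second incident edge. A root that
  -- is a leaf is the only vertex, so a child would close a cycle.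
  leaf-childless : ∀ {v w} → IsLeaf v → ¬ (v ⟶ w)
  leaf-childless {v} (inj₁ (v≢root , inc)) e with unsnoc (path v)
  ... | inj₁ root≡v      = v≢root (sym root≡v)
  ... | inj₂ (s , _ , f) with trans (sym (Inverse.strictlyInverseʳ inc (inj₁ (_ , e))))
                             (trans (cong (Inverse.from inc) (Fin1-prop _ _))
                                    (Inverse.strictlyInverseʳ inc (inj₂ (s , f))))
    where
    Fin1-prop : (i j : Fin 1) → i ≡ j
    Fin1-prop zero zero = refl
  ...   | ()
  leaf-childless (inj₂ (refl , w≡root)) e = no-cycle T e (subst (Star _⟶_ _) (w≡root _) ε)

  -- A childless root reaches nothing but itself; for any other childless vertex the unique incoming
  -- edge is the sole incident edge.
  childless-leaf : ∀ {v} → (∀ w → ¬ (v ⟶ w)) → IsLeaf v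
  childless-leaf {v} childless with unsnoc (path v)
  ... | inj₁ refl = inj₂ (refl , λ w → all-root (path w))
    where
    all-root : ∀ {w} → Star _⟶_ root w → w ≡ root
    all-root ε       = refl
    all-root (e ◅ _) = ⊥-elim (childless _ e)
  ... | inj₂ (s , _ , e) = inj₁
    ( (λ { refl → no-cycle T e (path s) })
    , mk↔ₛ′ (λ _ → zero) (λ _ → inj₂ (s , e)) (λ { zero → refl })
        (λ { (inj₁ (w , f)) → ⊥-elim (childless w f)
           ; (inj₂ (_ , f)) → cong inj₂ (parent-unique e f) }))

  Leaf-childless : ∀ (l : Leaf) {w} → ¬ (value l ⟶ w)
  Leaf-childless (v , [ isLeaf ]) e = ⊥-elim-irr (leaf-childless isLeaf e)

  -- Boundary paths are compared through their vertices. The vertices on the path to a leaf are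
  -- exactly those from which the leaf can be reached.
  On : Boundary → Vertex → Set a
  On (infinite p) v = ∃ λ n → v ≡ at p n
  On (toLeaf l)   v = Star _⟶_ v (value l)

  edges⇒star : ∀ {u w s t} {e : s ⟶ t} (p : Star _⟶_ u w) → (s , t , e) ∈ edges p → Star _⟶_ t w
  edges⇒star (_ ◅ p) (here refl) = p
  edges⇒star (_ ◅ p) (there i)   = edges⇒star p i

  ∈-edges-◅◅ : ∀ {u s t w} (p : Star _⟶_ u s) (e : s ⟶ t) (q : Star _⟶_ t w) →
               (s , t , e) ∈ edges (p ◅◅ e ◅ q)
  ∈-edges-◅◅ ε       e q = here refl
  ∈-edges-◅◅ (_ ◅ p) e q = there (∈-edges-◅◅ p e q)

  On-parent : ∀ ρ {s t} → s ⟶ t → On ρ t → On ρ s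
  On-parent (toLeaf _) e q = e ◅ q
  On-parent (infinite p) e (zero , refl) =
    ⊥-elim (no-cycle T (subst (_ ⟶_) (starts p) e) (path _))
  On-parent (infinite p) e (suc n , refl) = n , cong proj₁ (parent-unique e (step p n))

  On-ancestor : ∀ ρ {u v} → Star _⟶_ u v → On ρ v → On ρ u
  On-ancestor ρ ε       o = o
  On-ancestor ρ (e ◅ p) o = On-parent ρ e (On-ancestor ρ p o)

  segment : ∀ p {m n} → m ℕ.≤′ n → Star _⟶_ (at p m) (at p n)
  segment p (ℕ.≤′-reflexive refl) = ε
  segment p (ℕ.≤′-step m≤n)       = segment p m≤n ◅◅ step p _ ◅ ε

  On-comparable : ∀ ρ {u v} → On ρ u → On ρ v → Star _⟶_ u v ⊎ Star _⟶_ v u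
  On-comparable (toLeaf _)   p q = comparable p q
  On-comparable (infinite p) (m , refl) (n , refl) with ℕ.≤-total m n
  ... | inj₁ m≤n = inj₁ (segment p (ℕ.≤⇒≤′ m≤n))
  ... | inj₂ n≤m = inj₂ (segment p (ℕ.≤⇒≤′ n≤m))

  -- If `u` were strictly above `u′`, it would lie above the common parent `w`, which closes a
  -- cycle.
  comparable-siblings : ∀ {w u u′} (e : w ⟶ u) (e′ : w ⟶ u′) → Star _⟶_ u u′ → _≡_ {A = ∃ (w ⟶_)} (u , e) (u′ , e′)
  comparable-siblings e e′ p with above-child p e′
  ... | inj₂ q = ⊥-elim (no-cycle T e q)
  ... | inj₁ refl with parent-unique e e′
  ...   | refl = refl

  On-child-unique : ∀ ρ {w u u′} (e : w ⟶ u) (e′ : w ⟶ u′) → On ρ u → On ρ u′ →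
                    _≡_ {A = ∃ (w ⟶_)} (u , e) (u′ , e′)
  On-child-unique ρ e e′ o o′ with On-comparable ρ o o′
  ... | inj₁ p = comparable-siblings e e′ p
  ... | inj₂ p = sym (comparable-siblings e′ e p)

  -- Only one edge enters `t`, so a path through `t` must use it unless it starts there, and the
  -- root has no parent.
  ∈ᵉ⇔On : ∀ ρ {s t} {e : s ⟶ t} → (s , t , e) ∈ᵉ ρ ⇔ On ρ t
  ∈ᵉ⇔On (toLeaf (w , _)) {s} {t} {e} = mk⇔ (edges⇒star (path w))
    λ q → subst (λ p → (s , t , e) ∈ edges p)
                (path-unique (path s ◅◅ e ◅ q) (path w)) (∈-edges-◅◅ (path s) e q)
  ∈ᵉ⇔On (infinite p) {e = e} = mk⇔ (λ { (n , refl) → suc n , refl }) λ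
    { (zero , refl) → ⊥-elim (no-cycle T (subst (_ ⟶_) (starts p) e) (path _))
    ; (suc n , refl) → n , cong (λ { (s , e) → s , _ , e }) (parent-unique e (step p n)) }

  ≈∂-sym : ∀ {ρ τ} → ρ ≈∂ τ → τ ≈∂ ρ
  ≈∂-sym (infinite h) = infinite (λ n → sym (h n))
  ≈∂-sym (toLeaf eq)  = toLeaf (sym eq)

  ≈∂-trans : ∀ {ρ σ τ} → ρ ≈∂ σ → σ ≈∂ τ → ρ ≈∂ τ
  ≈∂-trans (infinite h) (infinite k) = infinite (λ n → trans (h n) (k n))
  ≈∂-trans (toLeaf h)   (toLeaf k)   = toLeaf (trans h k)

  ≈∂⇒On : ∀ {ρ τ v} → ρ ≈∂ τ → On ρ v → On τ v
  ≈∂⇒On (infinite h) (n , eq) = n , trans eq (h n)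
  ≈∂⇒On (toLeaf eq)  o        = subst (Star _⟶_ _) eq o

  -- Boundary paths are maximal, so an inclusion is already an equality.
  On-⊆⇒≈∂ : ∀ ρ τ → (∀ v → On ρ v → On τ v) → ρ ≈∂ τ
  On-⊆⇒≈∂ (infinite p) (infinite q) h = infinite λ n →
    let (m , eq) = h (at p n) (n , refl)
    -- `m` equals `n`, since the vertex at index `k` of an infinite path has depth `k`.
    in trans eq (cong (at q) (trans (sym (depth-at q m)) (trans (cong depth (sym eq)) (depth-at p n))))
  On-⊆⇒≈∂ (infinite p) (toLeaf (w , _)) h =
    -- An infinite path has a vertex one level deeper than `w`, and such a vertex cannot lie above
    -- `w`.
    let q = h (at p (suc (depth w))) (suc (depth w) , refl)
    in ⊥-elim (ℕ.m≢1+m+n (depth w)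
         (trans (depth-◅◅ q) (cong (ℕ._+ len T q) (depth-at p (suc (depth w))))))
  On-⊆⇒≈∂ (toLeaf l) (infinite p) h with h (value l) ε
  ... | n , eq = ⊥-elim (Leaf-childless l (subst (_⟶ at p (suc n)) (sym eq) (step p n)))
  On-⊆⇒≈∂ (toLeaf l@(_ , _)) (toLeaf (_ , _)) h with h (value l) ε
  ... | ε     = toLeaf refl
  ... | e ◅ _ = ⊥-elim (Leaf-childless l e)

  -- Either some childless vertex lies below `u` and ends a path, or every vertex below `u` has a
  -- child and the path through `u` can be continued forever.
  On-extension : ExcludedMiddle a → ∀ u → ∃ λ ρ → On ρ u
  On-extension em u with em {∃ λ w → Star _⟶_ u w × (∀ x → ¬ (w ⟶ x))}
  ... | yes (w , p , childless) = toLeaf (w , [ childless-leaf childless ]) , p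
  ... | no ¬leaf = infinite through-u , reaches (root , inj₁ (path u)) (path u) refl 0 refl
    where
    -- A vertex above u together with the way to u, or a vertex below u.
    State : Set a
    State = ∃ λ x → Star _⟶_ x u ⊎ Star _⟶_ u x

    child : ∀ {w} → Star _⟶_ u w → ∃ (w ⟶_)
    child {w} p with em {∃ (w ⟶_)}
    ... | yes c = c
    ... | no ¬c = ⊥-elim (¬leaf (w , p , λ x e → ¬c (x , e)))

    next : State → State
    next (_ , inj₁ (_ ◅ p)) = _ , inj₁ p
    next (_ , inj₁ ε)       = _ , inj₂ (proj₂ (child ε) ◅ ε)
    next (_ , inj₂ p)       = _ , inj₂ (p ◅◅ proj₂ (child p) ◅ ε)

    next-edge : ∀ x → proj₁ x ⟶ proj₁ (next x)
    next-edge (_ , inj₁ (e ◅ _)) = e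
    next-edge (_ , inj₁ ε)       = proj₂ (child ε)
    next-edge (_ , inj₂ p)       = proj₂ (child p)

    state : ℕ → State
    state zero    = root , inj₁ (path u)
    state (suc n) = next (state n)

    through-u : InfinitePath
    through-u = record
      { at = λ n → proj₁ (state n) ; starts = refl ; step = λ n → next-edge (state n) }

    -- Induction on the rest of the way to `u`: each application of `next` removes one edge from it.
    reaches : ∀ x (p : Star _⟶_ (proj₁ x) u) → proj₂ x ≡ inj₁ p →
              ∀ n → state n ≡ x → On (infinite through-u) u
    reaches x ε       _    n eq = n , sym (cong proj₁ eq)
    reaches x (_ ◅ p) refl n eq = reaches _ p refl (suc n) (cong next eq)

-- The locally finite component

module Component {a : Level} (em : ExcludedMiddle a) (T : RootedTree a) where
  open RootedTree T
  open Paths T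
  private
    T₀′ = T₀ T
    module R₀ = RootedTree T₀′
    module P₀ = Paths T₀′

  V₀-≡ : {v w : V₀ T} → value v ≡ value w → v ≡ w
  V₀-≡ {_ , [ _ ]} {_ , [ _ ]} refl = refl

  -- Membership is stored irrelevantly; as a decision procedure, excluded middle recovers a relevant
  -- proof.
  value∈V₀ : (v : V₀ T) → InV₀ T (value v)
  value∈V₀ (v , [ iv ]) = recompute em iv

  lift-star : ∀ {u v : V₀ T} → Star _⟶_ (value u) (value v) → Star R₀._⟶_ u v
  lift-star {_ , [ iu ]} {_ , [ iv ]} p = lift T iu iv p

  star⇒∈vertices : ∀ {x v} → Star _⟶_ x v → x ∈ vertices (path v)
  star⇒∈vertices {x} {v} q = subst (λ p → x ∈ vertices p) (path-unique (path x ◅◅ q) (path v))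
    (extend T (path x) q (end∈vertices (path x)))
    where
    end∈vertices : ∀ {u w} (p : Star _⟶_ u w) → w ∈ vertices p
    end∈vertices ε       = here refl
    end∈vertices (_ ◅ p) = there (end∈vertices p)

  proper-ancestor-finite : ∀ {x y v} → InV₀ T v → x ⟶ y → Star _⟶_ y v → FiniteValence x
  proper-ancestor-finite {x} iv e q =
    iv x (star⇒∈vertices (e ◅ q)) λ { refl → no-cycle T e q }

  -- A proper ancestor of `w` is either `u` itself or a proper ancestor of `u`.
  child∈V₀ : ∀ {u w} → InV₀ T u → FiniteValence u → u ⟶ w → InV₀ T w
  child∈V₀ {u} {w} iu fu e x x∈ x≢w with above-child (rest T (path w) x∈) e
  ... | inj₁ x≡w = ⊥-elim (x≢w x≡w)
  ... | inj₂ p with em {x ≡ u}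
  ...   | yes refl = fu
  ...   | no x≢u   = iu x (star⇒∈vertices p) x≢u

  -- Walking down from `u`, membership in `V₀` passes on through every vertex of finite valence, so
  -- it still holds at the first vertex of infinite valence.
  first-infinite : ∀ {u v} → Star _⟶_ u v → InV₀ T u → ¬ FiniteValence v →
                   ∃ λ w → Star _⟶_ w v × InV₀ T w × ¬ FiniteValence w
  first-infinite ε iu ¬fv = _ , ε , iu , ¬fv
  first-infinite {u} (e ◅ p) iu ¬fv with em {FiniteValence u}
  ... | yes fu = first-infinite p (child∈V₀ iu fu e) ¬fv
  ... | no ¬fu = u , e ◅ p , iu , ¬fu

  -- A child of `w` in `T₀` would have `w` as a proper ancestor and so force its valence to be
  -- finite.
  infinite-leaf : ∀ {w : V₀ T} → ¬ FiniteValence (value w) → R₀.IsLeaf w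
  infinite-leaf ¬fw = P₀.childless-leaf λ y e → ¬fw (proper-ancestor-finite (value∈V₀ y) e ε)

  -- Each earlier path passes through at most one child of `w`. If these were all the children, then
  -- together with at most one parent edge they would make the valence finite.
  fresh-child : ∀ {w} → ¬ FiniteValence w → ∀ {n} (τs : Vec Boundary n) →
                ∃ λ u → w ⟶ u × AllV.All (λ τ → ¬ On τ u) τs
  fresh-child {w} ¬fw τs with em {∃ λ u → w ⟶ u × AllV.All (λ τ → ¬ On τ u) τs}
  ... | yes fresh = fresh
  ... | no ¬fresh = ⊥-elim (¬fw (covered⇒finite em incidents covered))
    where
    -- Collects at most one child per path; a child outside the list is avoided by every path.
    used : ∀ {n} (τs : Vec Boundary n) → ∃ λ (cs : List (∃ (w ⟶_))) →
           ∀ c → c ∈ cs ⊎ AllV.All (λ τ → ¬ On τ (proj₁ c)) τs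
    used []       = [] , λ c → inj₂ []
    used (τ ∷ τs) with used τs | em {∃ λ (c : ∃ (w ⟶_)) → On τ (proj₁ c)}
    ... | cs , h | yes (c₀ , o) = c₀ ∷ cs , λ c → cover c (h c)
      where
      cover : ∀ c → c ∈ cs ⊎ AllV.All (λ τ → ¬ On τ (proj₁ c)) τs →
              c ∈ c₀ ∷ cs ⊎ AllV.All (λ τ → ¬ On τ (proj₁ c)) (τ ∷ τs)
      cover c (inj₁ i) = inj₁ (there i)
      cover c (inj₂ avoids) with em {On τ (proj₁ c)}
      ... | yes o′ = inj₁ (here (On-child-unique τ (proj₂ c) (proj₂ c₀) o′ o))
      ... | no ¬o  = inj₂ (¬o ∷ avoids)
    ... | cs , h | no ¬c = cs , λ c → cover c (h c)
      where
      cover : ∀ c → c ∈ cs ⊎ AllV.All (λ τ → ¬ On τ (proj₁ c)) τs →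
              c ∈ cs ⊎ AllV.All (λ τ → ¬ On τ (proj₁ c)) (τ ∷ τs)
      cover c (inj₁ i)      = inj₁ i
      cover c (inj₂ avoids) = inj₂ ((λ o → ¬c (c , o)) ∷ avoids)

    children : List (Incident w)
    children = List.map inj₁ (proj₁ (used τs))

    child∈ : ∀ c → inj₁ c ∈ children
    child∈ c@(u , e) with proj₂ (used τs) c
    ... | inj₁ i      = ∈-map⁺ inj₁ i
    ... | inj₂ avoids = ⊥-elim (¬fresh (u , e , avoids))

    -- Shared by `incidents` and `covered`, so that the case distinction in the latter evaluates the
    -- former.
    parent? : Dec (∃ (_⟶ w))
    parent? = em

    with-parent : Dec (∃ (_⟶ w)) → List (Incident w)
    with-parent (yes p) = inj₂ p ∷ children
    with-parent (no _)  = children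

    incidents : List (Incident w)
    incidents = with-parent parent?

    covered : ∀ i → i ∈ incidents
    covered i with parent?
    covered (inj₁ c)       | yes _       = there (child∈ c)
    covered (inj₂ (_ , e)) | yes (_ , f) = here (cong inj₂ (parent-unique e f))
    covered (inj₁ c)       | no _        = child∈ c
    covered (inj₂ p)       | no ¬p       = ⊥-elim (¬p p)

  -- ρ₀ is the part of ρ inside T₀.
  record _▷_ (ρ : Boundary) (ρ₀ : R₀.Boundary) : Set a where
    constructor restricts
    field on : ∀ v → P₀.On ρ₀ v ⇔ On ρ (value v)

  open _▷_

  -- A vertex of `V₀` strictly below `w` would force `w` to have finite valence, so inside `V₀` the
  -- path stops at `w`.
  On-truncated : ∀ ρ (w : V₀ T) → On ρ (value w) → ¬ FiniteValence (value w) → ∀ isLeaf →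
                 ρ ▷ R₀.toLeaf (w , isLeaf)
  On-truncated ρ w o ¬fw _ = restricts λ v → mk⇔ (λ p → On-ancestor ρ (lower T p) o) (from v)
    where
    from : ∀ v → On ρ (value v) → Star R₀._⟶_ v w
    from v o′ with On-comparable ρ o′ o
    ... | inj₁ p = lift-star p
    ... | inj₂ p = lift-star (below (value∈V₀ v) p)
      where
      below : ∀ {v} → InV₀ T v → Star _⟶_ (value w) v → Star _⟶_ v (value w)
      below iv ε       = ε
      below iv (e ◅ p) = ⊥-elim (¬fw (proper-ancestor-finite iv e p))

  -- These are the paths created by a cut. They end at exactly the leaves to which `χ₀` gives
  -- capacity `∞`.
  Truncated : R₀.Boundary → Set a
  Truncated (infinite _) = Level.Lift a ⊥
  Truncated (toLeaf l)   = ¬ FiniteValence (value (value l))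

  -- A leaf of `T₀` with finite valence in `T` is a leaf of `T`, because any child of it in `T`
  -- would again belong to `V₀`.
  preimage : ∀ ρ₀ → ¬ Truncated ρ₀ → ∃ λ ρ → ρ ▷ ρ₀ × (∀ v → On ρ v → InV₀ T v)
  preimage (infinite q) _ =
      infinite (record { at     = value ∘ R₀.at q
                       ; starts = cong value (R₀.starts q)
                       ; step   = R₀.step q })
    , restricts (λ v → mk⇔ (λ (n , eq) → n , cong value eq) (λ (n , eq) → n , V₀-≡ eq))
    , λ { v (n , refl) → value∈V₀ (R₀.at q n) }
  preimage (toLeaf l@(w , _)) ¬truncated =
      toLeaf (value w , [ childless-leaf childless ])
    , restricts (λ v → mk⇔ (lower T) lift-star)
    , λ v p → ancestor T p (value∈V₀ w)
    where
    childless : ∀ y → ¬ (value w ⟶ y)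
    childless y e with em {FiniteValence (value w)}
    ... | no ¬fw = ¬truncated ¬fw
    ... | yes fw = P₀.Leaf-childless l {y , [ child∈V₀ (value∈V₀ w) fw e ]} e

  -- The preimage `π` lies inside `V₀`, so every path with the same restriction contains it and, by
  -- maximality, equals it.
  preimage-unique : ∀ {ρ₀ ρ σ} → ¬ Truncated ρ₀ → ρ ▷ ρ₀ → σ ▷ ρ₀ → ρ ≈∂ σ
  preimage-unique {ρ₀} {ρ} {σ} ¬t h k with preimage ρ₀ ¬t
  ... | π , π▷ , π⊆ = ≈∂-trans (≈∂-sym (⊆ h)) (⊆ k)
    where
    ⊆ : ∀ {ρ} → ρ ▷ ρ₀ → π ≈∂ ρ
    ⊆ {ρ} h = On-⊆⇒≈∂ π ρ λ v o →
      let v₀ = v , [ π⊆ v o ]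
      in Equivalence.to (on h v₀) (Equivalence.from (on π▷ v₀) o)

  ▷-resp-≈∂ : ∀ {ρ ρ₀ σ₀} → ρ ▷ σ₀ → ρ₀ R₀.≈∂ σ₀ → ρ ▷ ρ₀
  ▷-resp-≈∂ h eq = restricts λ v → mk⇔ (Equivalence.to (on h v) ∘ P₀.≈∂⇒On eq)
                         (P₀.≈∂⇒On (P₀.≈∂-sym eq) ∘ Equivalence.from (on h v))

  ▷-≈∂ : ∀ {ρ τ ρ₀ τ₀} → ρ ▷ ρ₀ → τ ▷ τ₀ → ρ ≈∂ τ → ρ₀ R₀.≈∂ τ₀
  ▷-≈∂ {ρ₀ = ρ₀} {τ₀} h k eq = P₀.On-⊆⇒≈∂ ρ₀ τ₀ λ v →
    Equivalence.from (on k v) ∘ ≈∂⇒On eq ∘ Equivalence.to (on h v)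

  project : ∀ ρ → ∃ λ ρ₀ → ρ ▷ ρ₀
  project ρ with em {∃ λ v → On ρ v × ¬ FiniteValence v}
  ... | yes (v , o , ¬fv) with first-infinite (path v) (root∈V₀ T) ¬fv
  ...   | w , p , iw , ¬fw = R₀.toLeaf (w₀ , [ infinite-leaf {w₀} ¬fw ])
                           , On-truncated ρ w₀ (On-ancestor ρ p o) ¬fw _
    where
    w₀ : V₀ T
    w₀ = w , [ iw ]
  -- Without a vertex of infinite valence the path lies entirely in `V₀` and is kept whole.
  project ρ | no ¬infinite = ρ₀ ρ On∈V₀
    where
    On∈V₀ : ∀ v → On ρ v → InV₀ T v
    On∈V₀ v o w w∈ _ with em {FiniteValence w}
    ... | yes fw = fw
    ... | no ¬fw = ⊥-elim (¬infinite (w , On-ancestor ρ (rest T (path v) w∈) o , ¬fw))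
    ρ₀ : ∀ ρ → (∀ v → On ρ v → InV₀ T v) → ∃ λ ρ₀ → ρ ▷ ρ₀
    ρ₀ (infinite p) ⊆V₀ =
        R₀.infinite (record { at     = λ n → at p n , [ ⊆V₀ _ (n , refl) ]
                            ; starts = V₀-≡ (starts p)
                            ; step   = step p })
      , restricts λ v → mk⇔ (λ (n , eq) → n , cong value eq) (λ (n , eq) → n , V₀-≡ eq)
    ρ₀ (toLeaf l@(v , _)) ⊆V₀ =
        R₀.toLeaf ((v , [ ⊆V₀ v ε ]) , [ P₀.childless-leaf (λ _ → Leaf-childless l) ])
      , restricts λ v → mk⇔ (lower T) lift-star

  project-all : ∀ {n} (τs : Vec Boundary n) → ∃ λ (σs : Vec R₀.Boundary n) → Pointwise _▷_ τs σs
  project-all []       = [] , []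
  project-all (τ ∷ τs) =
    let (σ , h)   = project τ
        (σs , hs) = project-all τs
    in σ ∷ σs , h ∷ hs

  module Choices (ℓ : LengthFunction T) where
    open LengthFunction ℓ
    private
      ℓ₀′ = ℓ₀ T ℓ
      module L₀ = LengthFunction ℓ₀′

    -- Admissibility with and without capacity

    Fresh : ∀ {n} → Vec Boundary n → Boundary → Set a
    Fresh τs ρ = ¬ AnyV.Any (ρ ≈∂_) τs

    Admissible₀ : ∀ {n} → Vec R₀.Boundary n → R₀.Boundary → Set a
    Admissible₀ = AdmissibleWithCapacity em T₀′ ℓ₀′ (χ₀ T em)

    private
      module G  = Greedy T ℓ Fresh
      module G₀ = Greedy T₀′ ℓ₀′ Admissible₀

    admissible⇒fresh : ∀ {n} {σs : Vec R₀.Boundary n} {ρ₀} → ¬ Truncated ρ₀ →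
                       Admissible₀ σs ρ₀ → ¬ AnyV.Any (ρ₀ R₀.≈∂_) σs
    admissible⇒fresh _ (infinite fresh) = fresh
    admissible⇒fresh ¬t (toLeaf {w , _} count<χ) any with em {FiniteValence (value w)}
    admissible⇒fresh ¬t (toLeaf (fin count<1)) any | yes _ =
      -- Capacity 1 forces the count to be zero, whereas an earlier occurrence makes it positive.
      ℕ.<⇒≱ (Any⇒0<count _ any) (ℕ.≤-pred count<1)
    admissible⇒fresh ¬t _ any | no ¬fw = ¬t ¬fw

    -- Freshness is demanded of untruncated paths only: a truncated one ends at a leaf of capacity
    -- `∞` and may always be repeated.
    fresh⇒admissible : ∀ {n} {σs : Vec R₀.Boundary n} {ρ₀} →
                       (¬ Truncated ρ₀ → ¬ AnyV.Any (ρ₀ R₀.≈∂_) σs) → Admissible₀ σs ρ₀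
    fresh⇒admissible {ρ₀ = infinite _} fresh = infinite (fresh λ ())
    fresh⇒admissible {σs = σs} {toLeaf l@(w , _)} fresh = toLeaf below-capacity
      where
      below-capacity : Vec.count (λ τ → em {R₀.toLeaf l R₀.≈∂ τ}) σs <ᶜ χ₀ T em l
      below-capacity with em {FiniteValence (value w)}
      ... | yes fw = fin (s≤s (ℕ.≤-reflexive (¬Any⇒count≡0 _ (fresh λ ¬fw → ¬fw fw))))
      ... | no _   = ∞

    -- An untruncated `ρ₀` has only one preimage, so a repetition among `σs` would come from a
    -- repetition among `τs`.
    project-fresh : ∀ {n} {τs : Vec Boundary n} {σs : Vec R₀.Boundary n} {ρ ρ₀} → Pointwise _▷_ τs σs → ρ ▷ ρ₀ →
                    Fresh τs ρ → Admissible₀ σs ρ₀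
    project-fresh τs▷σs ρ▷ρ₀ fresh = fresh⇒admissible λ ¬t any →
      fresh (Pointwise-Any (λ {σ} {τ} τ▷σ eq → preimage-unique ¬t ρ▷ρ₀ (▷-resp-≈∂ τ▷σ eq))
                           (Pointwise.sym {Q = λ σ τ → τ ▷ σ} (λ h → h) τs▷σs) any)

    -- Comparison of pairings in the two trees

    down : R₀.Edge → Edge
    down (u , w , e) = value u , value w , e

    down-injective : ∀ {e e′} → down e ≡ down e′ → e ≡ e′
    down-injective {(_ , [ _ ]) , (_ , [ _ ]) , _} {(_ , [ _ ]) , (_ , [ _ ]) , _} refl = refl

    ▷-∈ᵉ : ∀ {ρ ρ₀} → ρ ▷ ρ₀ → ∀ e → e R₀.∈ᵉ ρ₀ ⇔ down e ∈ᵉ ρ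
    ▷-∈ᵉ {ρ} {ρ₀} h (u , w , e) = mk⇔
      (Equivalence.from (∈ᵉ⇔On ρ) ∘ Equivalence.to (on h w) ∘ Equivalence.to (P₀.∈ᵉ⇔On ρ₀))
      (Equivalence.from (P₀.∈ᵉ⇔On ρ₀) ∘ Equivalence.from (on h w) ∘ Equivalence.to (∈ᵉ⇔On ρ))

    length-down : ∀ es → List.map L₀.length es ≡ List.map length (List.map down es)
    length-down = List.map-∘

    total : List Edge → ℝ
    total es = sumℝ (List.map length es)

    total-mono-⊆ : ∀ {es fs} → es ⊆ fs → total es ≤ℝ total fs
    total-mono-⊆ [] = ≤ℝ-refl {0ℝ}
    total-mono-⊆ (_∷ʳ_ {es} {fs} f es⊆fs) =
      ≤ℝ-trans {total es} {total fs} {total (f ∷ fs)} (total-mono-⊆ es⊆fs)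
               (x≤ℝp+ℝx {length f} (total fs) (positive f))
    total-mono-⊆ (_∷_ {e} {es} {.e} {fs} refl es⊆fs) =
      +ℝ-mono-≤ℝ {length e} {length e} {total es} {total fs} (≤ℝ-refl {length e}) (total-mono-⊆ es⊆fs)

    -- Keeps the edges that come from `T₀`. The result is recorded as a sublist so that
    -- `total-mono-⊆` can bound its length.
    restrict : ∀ {es} → Unique es → ∃ λ es₀ →
               Unique es₀ × (∀ e → e ∈ es₀ ⇔ down e ∈ es) × List.map down es₀ ⊆ es
    restrict [] = [] , [] , (λ _ → mk⇔ (λ ()) (λ ())) , []
    restrict {e ∷ es} (e∉es ∷ unique) with restrict unique | em {∃ λ e₀ → down e₀ ≡ e}
    ... | es₀ , unique₀ , ∈⇔ , sub | yes (e₀ , refl) =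
        e₀ ∷ es₀
      , All.tabulate (λ {f} i eq → All.lookup e∉es (Equivalence.to (∈⇔ f) i) (cong down eq)) ∷ unique₀
      , (λ f → mk⇔ (λ { (here refl) → here refl ; (there i) → there (Equivalence.to (∈⇔ f) i) })
                   (λ { (here eq) → here (down-injective eq)
                      ; (there i) → there (Equivalence.from (∈⇔ f) i) }))
      , refl ∷ sub
    ... | es₀ , unique₀ , ∈⇔ , sub | no outside =
        es₀ , unique₀
      , (λ f → mk⇔ (there ∘ Equivalence.to (∈⇔ f))
                   (λ { (here eq) → ⊥-elim (outside (f , eq))
                      ; (there i) → Equivalence.from (∈⇔ f) i }))
      , e ∷ʳ sub

    -- The common edges of the restrictions are the common edges of `ρ` and `τ` that lie in `T₀`;
    -- discarding the others cannot increase the sum.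
    project-pairing : ∀ {ρ ρ₀ τ τ₀ x} → ρ ▷ ρ₀ → τ ▷ τ₀ → Pairing T ℓ ρ τ x →
                      ∃ λ x₀ → Pairing T₀′ ℓ₀′ ρ₀ τ₀ x₀ × x₀ ≤ℝ x
    project-pairing {x = x} h k (es , unique , ∈⇔ , x≈) =
      let (es₀ , unique₀ , ∈⇔₀ , sub) = restrict unique in
        total (List.map down es₀)
      , ( es₀ , unique₀
        , (λ e → mk⇔
            (λ i → let (r , t) = Equivalence.to (∈⇔ (down e)) (Equivalence.to (∈⇔₀ e) i)
                   in Equivalence.from (▷-∈ᵉ h e) r , Equivalence.from (▷-∈ᵉ k e) t)
            (λ (r , t) → Equivalence.from (∈⇔₀ e) (Equivalence.from (∈⇔ (down e))
              (Equivalence.to (▷-∈ᵉ h e) r , Equivalence.to (▷-∈ᵉ k e) t))))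
        , subst (λ ys → total (List.map down es₀) ≈ℝ sumℝ ys) (sym (length-down es₀))
                (≈ℝ-refl {total (List.map down es₀)}))
      , ≤ℝ-trans {total (List.map down es₀)} {total es} {x} (total-mono-⊆ sub)
          (≈ℝ⇒≤ℝ {total es} {x} (≈ℝ-sym {x} {total es} x≈))

    -- The condition under which cutting loses no common edge, so that the pairing is preserved
    -- exactly.
    MeetInside : Boundary → Boundary → Set a
    MeetInside ρ τ = ∀ v → On ρ v → On τ v → InV₀ T v

    -- On `ρ` a common vertex is comparable with `u`. At or below `u` it would put `u` on `τ`;
    -- otherwise it lies at or above `w`, hence in `V₀`.
    meet-inside : ∀ ρ τ {w u} → InV₀ T w → w ⟶ u → On ρ u → ¬ On τ u → MeetInside ρ τ
    meet-inside ρ τ iw e o ¬oτ v oρ oτ with On-comparable ρ oρ o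
    ... | inj₂ p = ⊥-elim (¬oτ (On-ancestor τ p oτ))
    ... | inj₁ p with above-child p e
    ...   | inj₁ refl = ⊥-elim (¬oτ oτ)
    ...   | inj₂ q    = ancestor T q iw

    -- A common edge has its target in `V₀` by assumption and its source there as an ancestor, so
    -- the same list of edges serves in both trees.
    lift-pairing : ∀ {ρ ρ₀ τ τ₀ x} → ρ ▷ ρ₀ → τ ▷ τ₀ → MeetInside ρ τ →
                   Pairing T₀′ ℓ₀′ ρ₀ τ₀ x → Pairing T ℓ ρ τ x
    lift-pairing {ρ} {τ = τ} {x = x} h k inside (es₀ , unique₀ , ∈⇔₀ , x≈) =
        List.map down es₀
      , Unique.map⁺ down-injective unique₀
      , (λ e → mk⇔ to (from e))
      , subst (λ ys → x ≈ℝ sumℝ ys) (length-down es₀) x≈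
      where
      to : ∀ {e} → e ∈ List.map down es₀ → e ∈ᵉ ρ × e ∈ᵉ τ
      to i =
        let (e₀ , i₀ , eq) = ∈-map⁻ down i
            (r , t)        = Equivalence.to (∈⇔₀ e₀) i₀
        in subst (λ e → e ∈ᵉ ρ × e ∈ᵉ τ) (sym eq)
                 (Equivalence.to (▷-∈ᵉ h e₀) r , Equivalence.to (▷-∈ᵉ k e₀) t)
      from : ∀ e → e ∈ᵉ ρ × e ∈ᵉ τ → e ∈ List.map down es₀
      from (s , t , e) (r , q) = ∈-map⁺ down {e₀} (Equivalence.from (∈⇔₀ e₀)
        (Equivalence.from (▷-∈ᵉ h e₀) r , Equivalence.from (▷-∈ᵉ k e₀) q))
        where
        it : InV₀ T t
        it = inside t (Equivalence.to (∈ᵉ⇔On ρ) r) (Equivalence.to (∈ᵉ⇔On τ) q)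
        e₀ : R₀.Edge
        e₀ = (s , [ ancestor T (e ◅ ε) it ]) , (t , [ it ]) , e

    project-sum : ∀ {n} {τs : Vec Boundary n} {σs : Vec R₀.Boundary n} {ρ ρ₀ s} → ρ ▷ ρ₀ → Pointwise _▷_ τs σs →
                  PairingSum T ℓ ρ τs s → ∃ λ s₀ → PairingSum T₀′ ℓ₀′ ρ₀ σs s₀ × s₀ ≤ℝ s
    project-sum {ρ = ρ} {ρ₀} {s} h ks (xs , pairings , s≈) =
      let (xs₀ , pairings₀ , ≤) = terms ks pairings in
        sumℝ (Vec.toList xs₀)
      , (xs₀ , pairings₀ , ≈ℝ-refl {sumℝ (Vec.toList xs₀)})
      , ≤ℝ-trans {sumℝ (Vec.toList xs₀)} {sumℝ (Vec.toList xs)} {s} ≤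
          (≈ℝ⇒≤ℝ {sumℝ (Vec.toList xs)} {s} (≈ℝ-sym {s} {sumℝ (Vec.toList xs)} s≈))
      where
      terms : ∀ {n} {τs : Vec Boundary n} {σs : Vec R₀.Boundary n} {xs : Vec ℝ n} → Pointwise _▷_ τs σs →
              Pointwise (Pairing T ℓ ρ) τs xs → ∃ λ (xs₀ : Vec ℝ n) →
              Pointwise (Pairing T₀′ ℓ₀′ ρ₀) σs xs₀ × sumℝ (Vec.toList xs₀) ≤ℝ sumℝ (Vec.toList xs)
      terms [] [] = [] , [] , ≤ℝ-refl {0ℝ}
      terms (k ∷ ks) (_∷_ {y = x} {ys = xs} p ps) =
        let (x₀ , p₀ , x₀≤)   = project-pairing {x = x} h k p
            (xs₀ , ps₀ , xs₀≤) = terms ks ps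
        in x₀ ∷ xs₀ , p₀ ∷ ps₀
         , +ℝ-mono-≤ℝ {x₀} {x} {sumℝ (Vec.toList xs₀)} {sumℝ (Vec.toList xs)} x₀≤ xs₀≤

    lift-sum : ∀ {n} {τs : Vec Boundary n} {σs : Vec R₀.Boundary n} {ρ ρ₀ s} → ρ ▷ ρ₀ → Pointwise _▷_ τs σs →
               AllV.All (MeetInside ρ) τs →
               PairingSum T₀′ ℓ₀′ ρ₀ σs s → PairingSum T ℓ ρ τs s
    lift-sum {ρ = ρ} {ρ₀} h ks insides (xs , pairings , s≈) = xs , terms ks insides pairings , s≈
      where
      terms : ∀ {n} {τs : Vec Boundary n} {σs : Vec R₀.Boundary n} {xs : Vec ℝ n} → Pointwise _▷_ τs σs →
              AllV.All (MeetInside ρ) τs → Pointwise (Pairing T₀′ ℓ₀′ ρ₀) σs xs →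
              Pointwise (Pairing T ℓ ρ) τs xs
      terms []       []             []       = []
      terms (k ∷ ks) (inside ∷ insides) (_∷_ {y = x} p ps) =
        lift-pairing {x = x} h k inside p ∷ terms ks insides ps

    FreshLift : ∀ {n} → Vec Boundary n → Vec R₀.Boundary n → R₀.Boundary → Set a
    FreshLift τs σs ρ₀ = ∃ λ ρ → ρ ▷ ρ₀ × Fresh τs ρ ×
      (∀ s → PairingSum T₀′ ℓ₀′ ρ₀ σs s → PairingSum T ℓ ρ τs s)

    fresh-lift : ∀ {n} {τs : Vec Boundary n} {σs : Vec R₀.Boundary n} → Pointwise _▷_ τs σs →
                 ∀ {ρ ρ₀} → ρ ▷ ρ₀ → Fresh τs ρ → AllV.All (MeetInside ρ) τs → FreshLift τs σs ρ₀
    fresh-lift τs▷σs ρ▷ρ₀ fresh insides =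
      _ , ρ▷ρ₀ , fresh , λ s → lift-sum {s = s} ρ▷ρ₀ τs▷σs insides

    -- Extend the path through a child `u` of `w` that no earlier choice visits. This makes the lift
    -- differ from all of them and meet them only inside `V₀`.
    lift-truncated : ∀ {n} {τs : Vec Boundary n} {σs : Vec R₀.Boundary n} → Pointwise _▷_ τs σs →
                     ∀ w isLeaf → ¬ FiniteValence (value w) →
                     FreshLift τs σs (R₀.toLeaf (w , isLeaf))
    lift-truncated {τs = τs} τs▷σs w isLeaf ¬fw =
      let (u , e , avoids) = fresh-child ¬fw τs
          (ρ , o)          = On-extension em u
      in fresh-lift τs▷σs (On-truncated ρ w (On-parent ρ e o) ¬fw isLeaf)
           (λ any → let (¬o , eq) = AllV.lookupAny avoids any in ¬o (≈∂⇒On eq o))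
           (AllV.map (λ {τ} → meet-inside ρ τ (value∈V₀ w) e o) avoids)

    lift-admissible : ∀ {n} {τs : Vec Boundary n} {σs : Vec R₀.Boundary n} → Pointwise _▷_ τs σs →
                      ∀ ρ₀ → Admissible₀ σs ρ₀ → FreshLift τs σs ρ₀
    lift-admissible {τs = τs} {σs} τs▷σs ρ₀ admissible = by-truncation ρ₀ admissible em
      where
      by-truncation : ∀ ρ₀ → Admissible₀ σs ρ₀ → Dec (Truncated ρ₀) → FreshLift τs σs ρ₀
      by-truncation (toLeaf (w , isLeaf)) _ (yes ¬fw) = lift-truncated τs▷σs w isLeaf ¬fw
      by-truncation ρ₀ admissible (no ¬t) =
        -- The whole preimage lies in `V₀`, hence so does its intersection with any earlier choice.
        let (ρ , ρ▷ρ₀ , ρ⊆V₀) = preimage ρ₀ ¬t in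
        fresh-lift τs▷σs ρ▷ρ₀
          (λ any → admissible⇒fresh ¬t admissible
            (Pointwise-Any (λ τ▷σ eq → ▷-≈∂ ρ▷ρ₀ τ▷σ eq) τs▷σs any))
          (AllV.universal (λ _ v o _ → ρ⊆V₀ v o) τs)

    -- Transfer of greedy choices and runs

    project-choice : ∀ {n} {τs : Vec Boundary n} {σs : Vec R₀.Boundary n} {ρ ρ₀ s} → Pointwise _▷_ τs σs → ρ ▷ ρ₀ →
                     G.Choice τs ρ s → G₀.Choice σs ρ₀ s
    project-choice {τs = τs} {σs} {ρ} {ρ₀} {s} τs▷σs ρ▷ρ₀ choice = record
      { admissible = admissible₀
      ; attained   =
          -- Cutting gives `s₀ ≤ s` and minimality gives `s ≤ s₀`, so the cut path attains `s`
          -- itself.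
          let (s₀ , sum@(xs , pairings , s₀≈) , s₀≤s) = project-sum {s = s} ρ▷ρ₀ τs▷σs attained
              x = sumℝ (Vec.toList xs)
          in xs , pairings , ≤ℝ-antisym {s} {x}
               (≤ℝ-trans {s} {s₀} {x} (minimal₀ ρ₀ s₀ admissible₀ sum) (≈ℝ⇒≤ℝ {s₀} {x} s₀≈))
               (≤ℝ-trans {x} {s₀} {s} (≈ℝ⇒≤ℝ {x} {s₀} (≈ℝ-sym {s₀} {x} s₀≈)) s₀≤s)
      ; minimal    = minimal₀
      }
      where
      open G.Choice choice
      admissible₀ : Admissible₀ σs ρ₀
      admissible₀ = project-fresh τs▷σs ρ▷ρ₀ admissible
      minimal₀ : ∀ ρ₀ s₀ → Admissible₀ σs ρ₀ → PairingSum T₀′ ℓ₀′ ρ₀ σs s₀ → s ≤ℝ s₀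
      minimal₀ ρ₀ s₀ admissible₀ sum₀ =
        let (ρ , _ , fresh , sums) = lift-admissible τs▷σs ρ₀ admissible₀
        in minimal ρ s₀ fresh (sums s₀ sum₀)

    -- The lift has the same sum and is minimal: cutting any competitor gives an admissible path of
    -- `T₀` whose sum is no larger.
    lift-choice : ∀ {n} {τs : Vec Boundary n} {σs : Vec R₀.Boundary n} {ρ₀ s} →
                  Pointwise _▷_ τs σs → G₀.Choice σs ρ₀ s → ∃ λ ρ → ρ ▷ ρ₀ × G.Choice τs ρ s
    lift-choice {ρ₀ = ρ₀} {s} τs▷σs choice =
      let (ρ , ρ▷ρ₀ , fresh , sums) = lift-admissible τs▷σs ρ₀ admissible in
      ρ , ρ▷ρ₀ , record
      { admissible = fresh
      ; attained   = sums s attained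
      ; minimal    = λ ρ′ s′ fresh′ sum′ →
          let (ρ₀′ , ρ′▷)         = project ρ′
              (s₀ , sum₀ , s₀≤s′) = project-sum {s = s′} ρ′▷ τs▷σs sum′
          in ≤ℝ-trans {s} {s₀} {s′}
               (minimal ρ₀′ s₀ (project-fresh τs▷σs ρ′▷ fresh′) sum₀) s₀≤s′
      }
      where
      open G₀.Choice choice

    project-run : ∀ {n} {τs : Vec Boundary n} {σs : Vec R₀.Boundary n} → Pointwise _▷_ τs σs → G.Run τs → G₀.Run σs
    project-run []       G.[]             = G₀.[]
    project-run (h ∷ hs) (choice G.∷ run) = project-choice hs h choice G₀.∷ project-run hs run

    -- Each lift depends on the lifts of all earlier choices, so the run is built from the earliest
    -- choice on, along with its restriction to `σs`.
    lift-run : ∀ {n} {σs : Vec R₀.Boundary n} → G₀.Run σs → ∃ λ (τs : Vec Boundary n) → Pointwise _▷_ τs σs × G.Run τs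
    lift-run G₀.[] = [] , [] , G.[]
    lift-run (choice G₀.∷ run) =
      let (τs , hs , run′)   = lift-run run
          (τ , h , choice′) = lift-choice hs choice
      in τ ∷ τs , h ∷ hs , choice′ G.∷ run′

proposition1p5 : {a : Level} (em : ExcludedMiddle a) (T : RootedTree a) (ℓ : LengthFunction T) (n : ℕ) (s : ℝ) →
    Factorial T ℓ n s ⇔ FactorialWithCapacity em (T₀ T) (ℓ₀ T ℓ) (χ₀ T em) n s
proposition1p5 em T ℓ n s = mk⇔
  (λ (τs , run , ρ , choice) →
    let (σs , hs) = project-all τs
        (ρ₀ , h)  = project ρ
    in σs , project-run hs run , ρ₀ , project-choice hs h choice)
  (λ (σs , run₀ , ρ₀ , choice₀) →
    let (τs , hs , run)   = lift-run run₀
        (ρ , _ , choice) = lift-choice hs choice₀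
    in τs , run , ρ , choice)
  where
  open Component em T
  open Choices ℓ
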